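{- For integers $\ell\ge 0$ and $k\ge 1$, let $c(\ell,k)$ denote the number of paths in an $X_k$ subtree of $T_B(\infty)$ originating from the root of the $X_k$ subtree (going from father to son) and having length $\ell$. Then $$c(\ell,k)=\begin{cases}1 & \text{if } \ell=0 \text{ or } k=1,\\[2pt] \displaystyle\sum_{i=1}^{\min(\ell,k)}c(\ell-i,i) & \text{otherwise.}\end{cases}$$ Moreover, for $n\ge 1$, the number $|L_B(n)|$ of partitions of $n$ is $c(n,n)$, and for $1\le k\le n$ the number of partitions of $n$ with length exactly $k$ is $c(n-k,k)$.
   Context: A partition is a finite sequence of integers $a=(a_1,\dots,a_k)$ with $a_1\ge\dots\ge a_k>0$ (the empty partition $()$ is allowed); $k$ is its length; by convention $a_j=0$ for $j>k$. $L_B(n)$ is the set of partitions of $n$ (those with $\sum_i a_i=n$). $a^{\downarrow_i}$ denotes the sequence obtained from $a$ by replacing $a_i$ by $a_i+1$. $T_B(\infty)$ is the edge-labeled rooted binary tree with root $()$ in which every node $a$ has a left son $a^{\downarrow_1}$ (edge labeled $1$), and in which a nonempty node $a$ has in addition a right son exactly when, with $p\ge 1$ denoting the number of parts of $a$ equal to $a_1$, one has $a_p-a_{p+1}=1$; the right son is then $a^{\downarrow_{p+1}}$ (edge labeled $p+1$). Its nodes are the partitions generated from the root in this way. For $k\ge 1$, an $X_k$ subtree is a subtree of $T_B(\infty)$ rooted at a node $a=(i,\dots,i,a_{k+1},\dots)$ whose first $k$ parts equal $i$ and with $a_{k+1}\le i-1$, and which is: the whole subtree of $T_B(\infty)$ rooted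 at $a$ if $a$ has only one son; and otherwise $a$ together with its left subtree (the whole subtree rooted at its left son, and the edge to it). For fixed $k$, all $X_k$ subtrees are isomorphic as edge-labeled rooted trees, so $c(\ell,k)$ does not depend on the choice of the $X_k$ subtree. -}

module Defs where

open import Data.Empty using (⊥)
open import Data.Fin using (Fin)
open import Data.List using (List; []; _∷_; length; filter; applyUpTo)
open import Data.List.Relation.Unary.All using (All)
open import Data.List.Relation.Unary.Linked using (Linked)
open import Data.Nat using (ℕ; zero; suc; _+_; _≤_; _<_; _>_; _≥_; _≟_)
open import Data.Nat.ListAction using (sum)
open import Data.Product using (_×_; ∃-syntax)
open import Data.Refinement using (Refinement-syntax)
open import Function.Bundles using (_↔_)
open import Relation.Binary.Construct.Closure.ReflexiveTransitive using (Star)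
open import Relation.Binary.PropositionalEquality using (_≡_)
open import Relation.Nullary using (¬_)

∑₁ : ℕ → (ℕ → ℕ) → ℕ
∑₁ n f = sum (applyUpTo (λ i → f (suc i)) n)

syntax ∑₁ n (λ i → e) = ∑[ 1≤ i ≤ n ] e

infix 1 _hasSize_

_hasSize_ : Set → ℕ → Set
A hasSize m = A ↔ Fin m

IsPartition : List ℕ → Set
IsPartition a = Linked _≥_ a × All (_> 0) a

L_B : ℕ → Set
L_B n = [ a ∈ List ℕ ∣ IsPartition a × sum a ≡ n ]

L_B-ofLength : ℕ → ℕ → Set
L_B-ofLength n k = [ a ∈ List ℕ ∣ IsPartition a × sum a ≡ n × length a ≡ k ]

-- part a j is a_j: positions are counted from 1, and a_j = 0 beyond the
-- length of a.  The value at position 0 is a dummy and is never used.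
part : List ℕ → ℕ → ℕ
part a       zero          = 0
part []      (suc _)       = 0
part (x ∷ _) (suc zero)    = x
part (_ ∷ a) (suc (suc j)) = part a (suc j)

infixl 6 _↓_

-- a ↓ i replaces a_i by a_i + 1 (again counting from 1, position 0 being a
-- dummy), where a is thought of as continued by zeros.
_↓_ : List ℕ → ℕ → List ℕ
a       ↓ zero        = a
[]      ↓ suc zero    = 1 ∷ []
[]      ↓ suc (suc i) = 0 ∷ ([] ↓ suc i)
(x ∷ a) ↓ suc zero    = suc x ∷ a
(x ∷ a) ↓ suc (suc i) = x ∷ (a ↓ suc i)

-- The number p of parts of a equal to a_1.
multiplicity₁ : List ℕ → ℕ
multiplicity₁ a = length (filter (_≟ part a 1) a)

HasRightSon : List ℕ → Set
HasRightSon []        = ⊥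
HasRightSon a@(_ ∷ _) = part a p ≡ 1 + part a (suc p)
  where p = multiplicity₁ a

-- The edges (father, label, son) of T_B(∞).  They are given on arbitrary lists;
-- the nodes of T_B(∞) are the lists reachable from the root [].
data Edge : List ℕ → ℕ → List ℕ → Set where
  left  : ∀ {a} → Edge a 1 (a ↓ 1)
  right : ∀ {a} → HasRightSon a →
          Edge a (suc (multiplicity₁ a)) (a ↓ suc (multiplicity₁ a))

Descendant : List ℕ → List ℕ → Set
Descendant = Star (λ a b → ∃[ l ] Edge a l b)

Node : List ℕ → Set
Node = Descendant []

record Subtree : Set₁ where
  field
    root     : List ℕ
    Contains : ∀ {a l b} → Edge a l b → Set

open Subtree public

wholeSubtree : List ℕ → Subtree
wholeSubtree a = record
  { root     = a
  ; Contains = λ {b} _ → Descendant a b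
  }

data InLeftPart (a : List ℕ) : ∀ {b l d} → Edge b l d → Set where
  top   : InLeftPart a (left {a})
  below : ∀ {b l d} {e : Edge b l d} → Descendant (a ↓ 1) b → InLeftPart a e

rootWithLeftSubtree : List ℕ → Subtree
rootWithLeftSubtree a = record
  { root     = a
  ; Contains = InLeftPart a
  }

-- a_1 = … = a_k = i and a_{k+1} ≤ i - 1.  The strict inequality forces i ≥ 1,
-- so a has at least k parts.
StartsWithBlock : ℕ → List ℕ → Set
StartsWithBlock k a =
  ∃[ i ] (∀ j → 1 ≤ j → j ≤ k → part a j ≡ i) × part a (suc k) < i

-- Every node has a left son, so having only one son means having no right son.
data IsXSubtree (k : ℕ) : Subtree → Set₁ where
  oneSon  : ∀ {a} → Node a → StartsWithBlock k a → ¬ HasRightSon a →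
            IsXSubtree k (wholeSubtree a)
  twoSons : ∀ {a} → Node a → StartsWithBlock k a → HasRightSon a →
            IsXSubtree k (rootWithLeftSubtree a)

-- Membership of the edges is irrelevant, so that a path is determined by the
-- edges it traverses.
data PathFrom (S : Subtree) : List ℕ → ℕ → Set where
  []   : ∀ {a} → PathFrom S a 0
  step : ∀ {a l b ℓ} (e : Edge a l b) → .(Contains S e) →
         PathFrom S b ℓ → PathFrom S a (suc ℓ)

RootPath : Subtree → ℕ → Set
RootPath S ℓ = PathFrom S (root S) ℓ

-- For k ≥ 1 the two fields together determine every value c ℓ k; the values
-- c ℓ 0 have no meaning.
record CountsPaths (c : ℕ → ℕ → ℕ) : Set₁ where
  field
    exists : ∀ k → 1 ≤ k → ∃[ S ] IsXSubtree k S
    counts : ∀ ℓ k → 1 ≤ k → ∀ S → IsXSubtree k S → RootPath S ℓ hasSize c ℓ k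

{-# OPTIONS --safe #-}

-- After a left step the largest part has multiplicity 1; each right step then
-- increases that multiplicity.  In an X_k subtree the left step from the root
-- can be followed by at most k − 1 right steps, since then the next part is
-- smaller by 2.  Hence a path is governed by two numbers: the multiplicity of
-- the largest part and the number of right steps still available.  The same
-- recursion counts the partitions of a number with length in a given interval:
-- when only one length is admitted, 1 is subtracted from every part.
module Submission where

open import Defs
open import Data.Nat using (ℕ; _≤_; _∸_; _⊓_)
open import Data.Product using (_×_; ∃-syntax)
open import Data.Sum using (_⊎_)
open import Relation.Binary.PropositionalEquality using (_≡_)
open import Relation.Nullary using (¬_)

open import Data.Empty using (⊥-elim-irr)
open import Data.Fin.Properties using (1↔⊤; +↔⊎)
open import Data.Irrelevant using ([_])
open import Data.List using (List; []; _∷_; _++_; length; replicate; filter; applyUpTo)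
open import Data.List.Properties using (filter-accept; filter-none; ≡-dec)
open import Data.List.Relation.Unary.All using (All; []; _∷_)
import Data.List.Relation.Unary.All as All
open import Data.List.Relation.Unary.All.Properties using (++⁺; replicate⁺)
open import Data.List.Relation.Unary.Linked using (Linked; []; [-]; _∷_)
import Data.List.Relation.Unary.Linked as Linked
open import Data.List.Relation.Unary.Linked.Properties using (Linked⇒All)
open import Data.Nat using (zero; suc; pred; _+_; _<_; _>_; _≥_; z≤n; s≤s; s≤s⁻¹; z<s; _≟_)
open import Data.Nat.ListAction using (sum)
open import Data.Nat.Properties
  using (≤-refl; ≤-trans; ≤-antisym; ≤-reflexive; ≤-<-trans; n≤1+n; n<1+n; <-irrefl; <⇒≢;
         ≤∧≢⇒<; m≤n⇒m≤1+n; m<n⇒m<1+n; m≤m+n; suc-injective; ≡-irrelevant;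
         +-suc; +-assoc; +-comm; +-identityʳ; +-cancelˡ-≡; +-monoʳ-≤; +-mono-≤; m+[n∸m]≡n)
open import Data.Product using (_,_; proj₁; proj₂)
open import Data.Refinement using (Refinement-syntax; value-injective)
open import Data.Refinement.Base using () renaming (_,_ to _,ʳ_)
open import Data.Sum using (inj₁; inj₂)
open import Data.Sum.Function.Propositional using (_⊎-↔_)
open import Data.Unit using (⊤; tt)
open import Function using (_∘_)
open import Function.Bundles using (_↔_; mk↔ₛ′)
open import Function.Properties.Inverse using (↔-sym) renaming (↔-trans to infixr 0 _⟫_)
open import Relation.Binary.Construct.Closure.ReflexiveTransitive using (ε; _◅_; _◅◅_)
open import Relation.Binary.Definitions using (DecidableEquality)
open import Relation.Binary.PropositionalEquality
  using (refl; sym; trans; cong; cong₂; subst; module ≡-Reasoning)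
open import Relation.Nullary using (yes; no; contradiction)
open import Relation.Nullary.Decidable using (recompute)
open import Relation.Unary using (Decidable)

-- The counting function and its unrolling into a sum.

-- pathCount ℓ s r is the number of paths of length ℓ when the largest part has
-- multiplicity s + 1 and r right steps are available before the next left step.
pathCount : ℕ → ℕ → ℕ → ℕ
pathCount zero    s r       = 1
pathCount (suc ℓ) s zero    = pathCount ℓ 0 s
pathCount (suc ℓ) s (suc r) = pathCount ℓ 0 s + pathCount ℓ (suc s) r

-- Group the paths by the number `i` of right steps before the first left step or the end. The
-- summand is an arbitrary `g` with pointwise equations, so that the induction can pass to `g ∘ suc`
-- although `s + suc i` and `suc s + i` are not definitionally equal.
pathCount-sum : ∀ ℓ s r (g : ℕ → ℕ) → (∀ i → g i ≡ pathCount (ℓ ∸ i) (s + i) 0) →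
                pathCount ℓ s r ≡ sum (applyUpTo g (suc (ℓ ⊓ r)))
pathCount-sum zero    s r       g g≡ = sym (trans (+-identityʳ (g 0)) (g≡ 0))
pathCount-sum (suc ℓ) s zero    g g≡ = begin
  pathCount ℓ 0 s        ≡⟨ cong (pathCount ℓ 0) (+-identityʳ s) ⟨
  pathCount ℓ 0 (s + 0)  ≡⟨ g≡ 0 ⟨
  g 0                    ≡⟨ +-identityʳ (g 0) ⟨
  g 0 + 0                ∎
  where open ≡-Reasoning
pathCount-sum (suc ℓ) s (suc r) g g≡ = cong₂ _+_
  (sym (trans (g≡ 0) (cong (pathCount ℓ 0) (+-identityʳ s))))
  (pathCount-sum ℓ (suc s) r (g ∘ suc)
    (λ i → trans (g≡ (suc i)) (cong (λ j → pathCount (ℓ ∸ i) j 0) (+-suc s i))))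

pathCount-0-0 : ∀ ℓ → pathCount ℓ 0 0 ≡ 1
pathCount-0-0 zero    = refl
pathCount-0-0 (suc ℓ) = pathCount-0-0 ℓ

-- Lists that begin with a block of equal parts.

part-block : ∀ s {x w} j → part (replicate s x ++ w) (suc (s + j)) ≡ part w (suc j)
part-block zero    j = refl
part-block (suc s) j = part-block s j

part-in-block : ∀ k {x w} j → 1 ≤ j → j ≤ k → part (replicate k x ++ w) j ≡ x
part-in-block (suc k) (suc zero)    _ _         = refl
part-in-block (suc k) (suc (suc j)) _ (s≤s j≤k) = part-in-block k (suc j) z<s j≤k

part-after-block : ∀ s {x w} → part (replicate s x ++ w) (suc s) ≡ part w 1
part-after-block zero    = refl
part-after-block (suc s) = part-after-block s

block-↓ : ∀ s {x w} → (replicate s x ++ w) ↓ suc s ≡ replicate s x ++ (w ↓ 1)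
block-↓ zero    = refl
block-↓ (suc s) = cong (_ ∷_) (block-↓ s)

block-snoc : ∀ s {x : ℕ} {w} → replicate s x ++ x ∷ w ≡ x ∷ replicate s x ++ w
block-snoc zero    = refl
block-snoc (suc s) = cong (_ ∷_) (block-snoc s)

count-block : ∀ s {x w} → All (_< x) w → length (filter (_≟ x) (replicate s x ++ w)) ≡ s
count-block zero    {x} w<x = cong length (filter-none (_≟ x) (All.map <⇒≢ w<x))
count-block (suc s) {x} w<x =
  trans (cong length (filter-accept (_≟ x) refl)) (cong suc (count-block s w<x))

-- As every part of `w` is smaller than `x`, the label of the right edge points at the first part of
-- `w`; an empty `w` gains a part 1.
block-raise : ∀ s {x w} → All (_< x) w →
              let a = replicate (suc s) x ++ w in
              a ↓ suc (multiplicity₁ a) ≡ x ∷ replicate s x ++ (w ↓ 1)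
block-raise s w<x rewrite count-block (suc s) w<x = block-↓ (suc s)

block-rightSon : ∀ s {x w} → All (_< x) w → x ≡ suc (part w 1) →
                 HasRightSon (replicate (suc s) x ++ w)
block-rightSon s {x} {w} w<x eq rewrite count-block (suc s) w<x = begin
  part (replicate (suc s) x ++ w) (suc s)            ≡⟨ part-in-block (suc s) (suc s) z<s ≤-refl ⟩
  x                                                  ≡⟨ eq ⟩
  suc (part w 1)                                     ≡⟨ cong suc (part-after-block s) ⟨
  suc (part (replicate s x ++ w) (suc s))            ∎
  where open ≡-Reasoning

rightSon-block : ∀ s {x w} → All (_< x) w → HasRightSon (replicate (suc s) x ++ w) →
                 x ≡ suc (part w 1)
rightSon-block s {x} {w} w<x h rewrite count-block (suc s) w<x = begin
  x                                                  ≡⟨ part-in-block (suc s) (suc s) z<s ≤-refl ⟨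
  part (replicate (suc s) x ++ w) (suc s)            ≡⟨ h ⟩
  suc (part (replicate s x ++ w) (suc s))            ≡⟨ cong suc (part-after-block s) ⟩
  suc (part w 1)                                     ∎
  where open ≡-Reasoning

-- Phases between consecutive left steps.

-- The lists from which, before the next left step, exactly r right steps can
-- be made: the parts equal to v + 1 are raised one by one to v + 2.
data Phase (s r : ℕ) : List ℕ → Set where
  phase : ∀ {v t} → All (_< suc v) t →
          Phase s r (replicate (suc s) (suc (suc v)) ++ replicate r (suc v) ++ t)

below-block : ∀ r {v t} → All (_< v) t → All (_< suc v) (replicate r v ++ t)
below-block r t<v = ++⁺ (replicate⁺ r (n<1+n _)) (All.map m<n⇒m<1+n t<v)

part₁< : ∀ {v t} → 0 < v → All (_< v) t → part t 1 < v
part₁< 0<v []        = 0<v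
part₁< 0<v (x<v ∷ _) = x<v

-- One of the `suc s` largest parts is raised; the other `s` now lie 1 below it and supply the right
-- steps of the new phase.
block-left : ∀ s {v t} → All (_< suc v) t →
             Phase 0 s ((replicate (suc s) (suc v) ++ t) ↓ 1)
block-left s t<v = phase t<v

-- Parts not yet raised in the old phase are now 2 below the largest part, so they join the tail.
phase-left : ∀ {s r b} → Phase s r b → Phase 0 s (b ↓ 1)
phase-left {s} {r} (phase t<v) = block-left s (below-block r t<v)

phase-right : ∀ {s r b} → Phase s (suc r) b → Phase (suc s) r (b ↓ suc (multiplicity₁ b))
phase-right {s} {r} (phase t<v) = subst (Phase (suc s) r)
  (sym (trans (block-raise s (below-block (suc r) t<v)) (block-snoc (suc s))))
  (phase t<v)

phase-hasRightSon : ∀ {s r b} → Phase s (suc r) b → HasRightSon b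
phase-hasRightSon {s} {r} (phase t<v) = block-rightSon s (below-block (suc r) t<v) refl

-- With no part `suc v` left, the largest part exceeds the next one by at least 2.
phase-noRightSon : ∀ {s b} → Phase s 0 b → ¬ HasRightSon b
phase-noRightSon {s} (phase t<v) h =
  <-irrefl (sym (suc-injective (rightSon-block s (below-block 0 t<v) h))) (part₁< z<s t<v)

-- Paths split by their first edge.

HasRightSon-irrelevant : ∀ a (h h′ : HasRightSon a) → h ≡ h′
HasRightSon-irrelevant (_ ∷ _) h h′ = ≡-irrelevant h h′

leftPaths : ∀ {S a ℓ} → .(Contains S (left {a})) → (∀ h → ¬ Contains S (right {a} h)) →
            PathFrom S a (suc ℓ) ↔ PathFrom S (a ↓ 1) ℓ
leftPaths {S} {a} {ℓ} l∈S r∉S = mk↔ₛ′ to (step left l∈S) (λ _ → refl) from∘to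
  where
  to : PathFrom S a (suc ℓ) → PathFrom S (a ↓ 1) ℓ
  to (step left      _ p) = p
  to (step (right h) c _) = ⊥-elim-irr (r∉S h c)

  from∘to : ∀ p → step left l∈S (to p) ≡ p
  from∘to (step left      _ _) = refl
  from∘to (step (right h) c _) = ⊥-elim-irr (r∉S h c)

bothPaths : ∀ {S a ℓ} → .(Contains S (left {a})) → (h : HasRightSon a) →
            .(Contains S (right {a} h)) →
            PathFrom S a (suc ℓ) ↔
              (PathFrom S (a ↓ 1) ℓ ⊎ PathFrom S (a ↓ suc (multiplicity₁ a)) ℓ)
bothPaths {S} {a} {ℓ} l∈S h r∈S = mk↔ₛ′ to from to∘from from∘to
  where
  Sons : Set
  Sons = PathFrom S (a ↓ 1) ℓ ⊎ PathFrom S (a ↓ suc (multiplicity₁ a)) ℓ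

  to : PathFrom S a (suc ℓ) → Sons
  to (step left      _ p) = inj₁ p
  to (step (right _) _ p) = inj₂ p

  from : Sons → PathFrom S a (suc ℓ)
  from (inj₁ p) = step left l∈S p
  from (inj₂ p) = step (right h) r∈S p

  to∘from : ∀ q → to (from q) ≡ q
  to∘from (inj₁ _) = refl
  to∘from (inj₂ _) = refl

  from∘to : ∀ p → from (to p) ≡ p
  from∘to (step left       _ _) = refl
  from∘to (step (right h′) c p) with refl ← HasRightSon-irrelevant a h h′ = refl

-- Treats both kinds of X_k subtree alike: each contains every edge below the left son of its root.
ContainsBelow : Subtree → List ℕ → Set
ContainsBelow S a = ∀ {b l d} (e : Edge b l d) → Descendant a b → Contains S e

containsBelow-son : ∀ {S a l b} → Edge a l b → ContainsBelow S a → ContainsBelow S b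
containsBelow-son e inside e′ b⇝d = inside e′ ((_ , e) ◅ b⇝d)

emptyPath : ∀ {S a} → PathFrom S a 0 ↔ ⊤
emptyPath = mk↔ₛ′ (λ _ → tt) (λ _ → []) (λ _ → refl) (λ { [] → refl })

-- The phase decides which sons exist and which phases they are in, so the recursion of `pathCount`
-- is followed edge by edge.
paths-hasSize : ∀ {S} ℓ {s r a} → Phase s r a → ContainsBelow S a →
                PathFrom S a ℓ hasSize pathCount ℓ s r
paths-hasSize zero ph inside = emptyPath ⟫ ↔-sym 1↔⊤
paths-hasSize {S} (suc ℓ) {s} {zero} ph inside =
  leftPaths (inside left ε) (λ h _ → phase-noRightSon ph h)
  ⟫ paths-hasSize ℓ (phase-left ph) (containsBelow-son {S} left inside)
paths-hasSize {S} (suc ℓ) {s} {suc r} ph inside =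
  bothPaths (inside left ε) h (inside (right h) ε)
  ⟫ paths-hasSize ℓ (phase-left ph) (containsBelow-son {S} left inside)
    ⊎-↔ paths-hasSize ℓ (phase-right ph) (containsBelow-son {S} (right h) inside)
  ⟫ ↔-sym +↔⊎
  where h = phase-hasRightSon ph

-- Order and sum along the edges of the tree.

-- The raised part becomes equal to its predecessor. For `j` equal to 0 the dummy value of `part`
-- makes the equation absurd.
raise-linked : ∀ a j → Linked _≥_ a → part a j ≡ suc (part a (suc j)) →
               Linked _≥_ (a ↓ suc j)
raise-linked (x ∷ [])    (suc zero)          _        eq = ≤-reflexive (sym eq) ∷ [-]
raise-linked (x ∷ y ∷ a) (suc zero) (x≥y ∷ [-])       eq = ≤-reflexive (sym eq) ∷ [-]
raise-linked (x ∷ y ∷ a) (suc zero) (x≥y ∷ y≥z ∷ lnk) eq =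
  ≤-reflexive (sym eq) ∷ m≤n⇒m≤1+n y≥z ∷ lnk
raise-linked (x ∷ y ∷ a) (suc (suc j)) (x≥y ∷ lnk)    eq = x≥y ∷ raise-linked (y ∷ a) (suc j) lnk eq

left-linked : ∀ {a} → Linked _≥_ a → Linked _≥_ (a ↓ 1)
left-linked []          = [-]
left-linked [-]         = [-]
left-linked (x≥y ∷ lnk) = m≤n⇒m≤1+n x≥y ∷ lnk

edge-linked : ∀ {a l b} → Edge a l b → Linked _≥_ a → Linked _≥_ b
edge-linked left lnk = left-linked lnk
edge-linked {a = a@(_ ∷ _)} (right h) lnk = raise-linked a (multiplicity₁ a) lnk h

descendant-linked : ∀ {a b} → Descendant a b → Linked _≥_ a → Linked _≥_ b
descendant-linked ε               lnk = lnk
descendant-linked ((_ , e) ◅ a⇝b) lnk = descendant-linked a⇝b (edge-linked e lnk)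

sum-↓ : ∀ a i → sum (a ↓ suc i) ≡ suc (sum a)
sum-↓ []      zero    = refl
sum-↓ []      (suc i) = sum-↓ [] i
sum-↓ (x ∷ a) zero    = refl
sum-↓ (x ∷ a) (suc i) = trans (cong (x +_) (sum-↓ a i)) (+-suc x (sum a))

descendant-sum : ∀ {a b} → Descendant a b → sum a ≤ sum b
descendant-sum ε                   = ≤-refl
descendant-sum {a} ((_ , e) ◅ b⇝d) =
  ≤-trans (≤-trans (n≤1+n _) (≤-reflexive (sym (edge-sum e)))) (descendant-sum b⇝d)
  where
  edge-sum : ∀ {a l b} → Edge a l b → sum b ≡ suc (sum a)
  edge-sum {a} left      = sum-↓ a 0
  edge-sum {a} (right _) = sum-↓ a (multiplicity₁ a)

-- Counting paths in X_k subtrees.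

data IsRight : ∀ {a l b} → Edge a l b → Set where
  isRight : ∀ {a h} → IsRight (right {a} h)

-- Stated for an arbitrary edge, as Agda cannot unify the indices of left and right.
inLeftPart-right : ∀ {a b l d} {e : Edge b l d} → InLeftPart a e → IsRight e →
                   Descendant (a ↓ 1) b
inLeftPart-right (below a⇝b) _ = a⇝b

-- Otherwise the root would descend from its own left son, whose sum is already larger by 1, while
-- sums never decrease along a descent.
right∉leftPart : ∀ {a} h → ¬ InLeftPart a (right {a} h)
right∉leftPart {a} h r∈ =
  <-irrefl refl (≤-trans (≤-reflexive (sym (sum-↓ a 0))) (descendant-sum (inLeftPart-right r∈ isRight)))

linked-below : ∀ {i t} → Linked _≥_ t → part t 1 < i → All (_< i) t
linked-below {t = []}    _   _   = []
linked-below {t = x ∷ t} lnk x<i =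
  All.map (λ x≥y → ≤-<-trans x≥y x<i) (Linked⇒All (λ x≥y y≥z → ≤-trans y≥z x≥y) ≤-refl lnk)

block-decompose : ∀ k {i a} → Linked _≥_ a → (∀ j → 1 ≤ j → j ≤ k → part a j ≡ i) →
                  part a (suc k) < i → ∃[ t ] a ≡ replicate k i ++ t × All (_< i) t
block-decompose zero    {a = a} lnk eq <i = a , refl , linked-below lnk <i
-- The first part of the empty list is 0, so `i` is 0 and no part is smaller.
block-decompose (suc k) {a = []} lnk eq <i with refl ← eq 1 z<s z<s = contradiction <i λ ()
block-decompose (suc k) {a = x ∷ a} lnk eq <i
  with refl ← eq 1 z<s z<s
  with t , refl , t<i ← block-decompose k (Linked.tail lnk)
         (λ { (suc j) 1≤j j≤k → eq (suc (suc j)) z<s (s≤s j≤k) }) <i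
  = t , refl , t<i

subtree-hasSize : ∀ S ℓ k {v t} → root S ≡ replicate (suc k) (suc v) ++ t → All (_< suc v) t →
                  Contains S (left {root S}) → (∀ h → ¬ Contains S (right {root S} h)) →
                  ContainsBelow S (root S ↓ 1) →
                  RootPath S ℓ hasSize pathCount ℓ k 0
subtree-hasSize S zero    k _  _   _   _   _     = emptyPath ⟫ ↔-sym 1↔⊤
subtree-hasSize S (suc ℓ) k eq t<i l∈S r∉S inside =
  leftPaths {S} l∈S r∉S ⟫ paths-hasSize ℓ phase₀ inside
  where
  phase₀ : Phase 0 k (root S ↓ 1)
  phase₀ = subst (λ a → Phase 0 k (a ↓ 1)) (sym eq) (block-left k t<i)

xSubtree-hasSize : ∀ ℓ k S → IsXSubtree (suc k) S → RootPath S ℓ hasSize pathCount ℓ k 0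
xSubtree-hasSize ℓ k S (oneSon {a} node (suc i , eq , <i) noRight)
  with t , a≡ , t<i ← block-decompose (suc k) (descendant-linked node []) eq <i
  = subtree-hasSize S ℓ k a≡ t<i ε (λ h _ → noRight h) (λ _ b⇝d → (_ , left) ◅ b⇝d)
xSubtree-hasSize ℓ k S (twoSons {a} node (suc i , eq , <i) _)
  with t , a≡ , t<i ← block-decompose (suc k) (descendant-linked node []) eq <i
  = subtree-hasSize S ℓ k a≡ t<i top right∉leftPart (λ _ → below)

-- In a nonempty list of ones the largest part exceeds the following 0 by 1, so a right step appends
-- another 1.
ones-node : ∀ k → Node (replicate k 1 ++ [])
ones-node zero          = ε
ones-node (suc zero)    = (1 , left) ◅ ε
ones-node (suc (suc k)) = subst Node (trans (block-raise k []) (block-snoc (suc k)))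
  (ones-node (suc k) ◅◅ ((_ , right (block-rightSon k [] refl)) ◅ ε))

ones-subtree : ∀ k → ∃[ S ] IsXSubtree (suc k) S
ones-subtree k = _ , twoSons (ones-node (suc k))
  (1 , part-in-block (suc k) , subst (_< 1) (sym (part-after-block (suc k) {1})) z<s)
  (block-rightSon k [] refl)

pathCount-countsPaths : CountsPaths (λ ℓ k → pathCount ℓ (pred k) 0)
pathCount-countsPaths = record
  { exists = λ { (suc k) _ → ones-subtree k }
  ; counts = λ { ℓ (suc k) _ S → xSubtree-hasSize ℓ k S }
  }

-- Bijections between sets of lists cut out by predicates.

_≟ᴸ_ : DecidableEquality (List ℕ)
_≟ᴸ_ = ≡-dec _≟_

-- Proofs of the predicates are irrelevant, so the equations between lists derived from them are
-- recovered by deciding equality.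
refinement-↔ : {P Q : List ℕ → Set} (to from : List ℕ → List ℕ) →
               (∀ {a} → P a → Q (to a)) → (∀ {b} → Q b → P (from b)) →
               (∀ {a} → P a → from (to a) ≡ a) → (∀ {b} → Q b → to (from b) ≡ b) →
               [ a ∈ List ℕ ∣ P a ] ↔ [ b ∈ List ℕ ∣ Q b ]
refinement-↔ to from P⇒Q Q⇒P from∘to to∘from = mk↔ₛ′
  (λ (a ,ʳ [ p ]) → to a ,ʳ [ P⇒Q p ])
  (λ (b ,ʳ [ q ]) → from b ,ʳ [ Q⇒P q ])
  (λ (b ,ʳ [ q ]) → value-injective (recompute (_ ≟ᴸ _) (to∘from q)))
  (λ (a ,ʳ [ p ]) → value-injective (recompute (_ ≟ᴸ _) (from∘to p)))

refinement-≡ : {P Q : List ℕ → Set} → (∀ {a} → P a → Q a) → (∀ {a} → Q a → P a) →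
               [ a ∈ List ℕ ∣ P a ] ↔ [ a ∈ List ℕ ∣ Q a ]
refinement-≡ P⇒Q Q⇒P = refinement-↔ (λ a → a) (λ a → a) P⇒Q Q⇒P (λ _ → refl) (λ _ → refl)

refinement-singleton : {P : List ℕ → Set} (a : List ℕ) → P a → (∀ {b} → P b → a ≡ b) →
                       [ b ∈ List ℕ ∣ P b ] ↔ ⊤
refinement-singleton a p unique = mk↔ₛ′ (λ _ → tt) (λ _ → a ,ʳ [ p ]) (λ _ → refl)
  (λ (b ,ʳ [ q ]) → value-injective (recompute (_ ≟ᴸ _) (unique q)))

refinement-split : {P D : List ℕ → Set} → Decidable D →
                   [ a ∈ List ℕ ∣ P a ] ↔
                     ([ a ∈ List ℕ ∣ P a × D a ] ⊎ [ a ∈ List ℕ ∣ P a × ¬ D a ])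
refinement-split {P} {D} D? = mk↔ₛ′ to from to∘from from∘to
  where
  Parts : Set
  Parts = [ a ∈ List ℕ ∣ P a × D a ] ⊎ [ a ∈ List ℕ ∣ P a × ¬ D a ]

  to : [ a ∈ List ℕ ∣ P a ] → Parts
  to (a ,ʳ [ p ]) with D? a
  ... | yes d = inj₁ (a ,ʳ [ p , d ])
  ... | no ¬d = inj₂ (a ,ʳ [ p , ¬d ])

  from : Parts → [ a ∈ List ℕ ∣ P a ]
  from (inj₁ (a ,ʳ [ p ])) = a ,ʳ [ proj₁ p ]
  from (inj₂ (a ,ʳ [ p ])) = a ,ʳ [ proj₁ p ]

  to∘from : ∀ b → to (from b) ≡ b
  to∘from (inj₁ (a ,ʳ [ p ])) with D? a
  ... | yes _ = refl
  ... | no ¬d = ⊥-elim-irr (¬d (proj₂ p))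
  to∘from (inj₂ (a ,ʳ [ p ])) with D? a
  ... | yes d = ⊥-elim-irr (proj₂ p d)
  ... | no  _ = refl

  from∘to : ∀ b → from (to b) ≡ b
  from∘to (a ,ʳ [ p ]) with D? a
  ... | yes _ = refl
  ... | no  _ = refl

-- Removing and adding the first column of a Young diagram.

-- On a weakly decreasing list, cutting off at the first part 1 drops only parts
-- that subtracting 1 makes zero.
peel : List ℕ → List ℕ
peel (suc (suc x) ∷ a) = suc x ∷ peel a
peel _                 = []

-- For `b` of length at most `s`, puts a first column of height `s` before the diagram of `b`; this
-- inverts `peel` on partitions of length `s`.
pad : ℕ → List ℕ → List ℕ
pad zero    _       = []
pad (suc s) []      = 1 ∷ pad s []
pad (suc s) (x ∷ b) = suc x ∷ pad s b

peel-positive : ∀ a → All (_> 0) (peel a)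
peel-positive []                = []
peel-positive (zero ∷ _)        = []
peel-positive (suc zero ∷ _)    = []
peel-positive (suc (suc _) ∷ a) = z<s ∷ peel-positive a

peel-linked : ∀ {a} → Linked _≥_ a → Linked _≥_ (peel a)
peel-linked []                                            = []
peel-linked ([-] {zero})                                  = []
peel-linked ([-] {suc zero})                              = []
peel-linked ([-] {suc (suc _)})                           = [-]
peel-linked (_∷_ {zero}        _                     _)   = []
peel-linked (_∷_ {suc zero}    _                     _)   = []
peel-linked (_∷_ {suc (suc _)} {zero}        _       _)   = [-]
peel-linked (_∷_ {suc (suc _)} {suc zero}    _       _)   = [-]
peel-linked (_∷_ {suc (suc _)} {suc (suc _)} x≥y     lnk) = s≤s⁻¹ x≥y ∷ peel-linked lnk

length-peel : ∀ a → length (peel a) ≤ length a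
length-peel []                = z≤n
length-peel (zero ∷ _)        = z≤n
length-peel (suc zero ∷ _)    = z≤n
length-peel (suc (suc _) ∷ a) = s≤s (length-peel a)

pad-positive : ∀ s b → All (_> 0) (pad s b)
pad-positive zero    _       = []
pad-positive (suc s) []      = z<s ∷ pad-positive s []
pad-positive (suc s) (_ ∷ b) = z<s ∷ pad-positive s b

pad-linked : ∀ s {b} → Linked _≥_ b → Linked _≥_ (pad s b)
pad-linked zero          _           = []
pad-linked (suc zero)    []          = [-]
pad-linked (suc (suc s)) []          = ≤-refl ∷ pad-linked (suc s) []
pad-linked (suc zero)    [-]         = [-]
pad-linked (suc (suc s)) [-]         = s≤s z≤n ∷ pad-linked (suc s) []
pad-linked (suc zero)    (_ ∷ _)     = [-]
pad-linked (suc (suc s)) (x≥y ∷ lnk) = s≤s x≥y ∷ pad-linked (suc s) lnk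

length-pad : ∀ s b → length (pad s b) ≡ s
length-pad zero    _       = refl
length-pad (suc s) []      = cong suc (length-pad s [])
length-pad (suc s) (_ ∷ b) = cong suc (length-pad s b)

sum-pad : ∀ s b → length b ≤ s → sum (pad s b) ≡ s + sum b
sum-pad zero    []      _         = refl
sum-pad (suc s) []      _         = cong suc (sum-pad s [] z≤n)
sum-pad (suc s) (x ∷ b) (s≤s len) = cong suc (begin
  x + sum (pad s b)  ≡⟨ cong (x +_) (sum-pad s b len) ⟩
  x + (s + sum b)    ≡⟨ +-comm x _ ⟩
  s + sum b + x      ≡⟨ +-assoc s _ x ⟩
  s + (sum b + x)    ≡⟨ cong (s +_) (+-comm _ x) ⟩
  s + (x + sum b)    ∎)
  where open ≡-Reasoning

peel-pad : ∀ s {b} → All (_> 0) b → length b ≤ s → peel (pad s b) ≡ b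
peel-pad zero    []        _         = refl
peel-pad (suc s) []        _         = refl
peel-pad (suc s) (z<s ∷ b) (s≤s len) = cong (_ ∷_) (peel-pad s b len)

-- Parts after a 1 are at most 1. This reconciles `peel`, which stops at the first 1, with the
-- recursion of `pad-peel`, which continues into the tail.
peel-tail-[] : ∀ {a} → Linked _≥_ (1 ∷ a) → peel a ≡ []
peel-tail-[] [-]                     = refl
peel-tail-[] (_∷_ {y = zero}     _ _) = refl
peel-tail-[] (_∷_ {y = suc zero} _ _) = refl
peel-tail-[] (_∷_ {y = suc (suc _)} (s≤s ()) _)

pad-peel : ∀ {a} → IsPartition a → pad (length a) (peel a) ≡ a
pad-peel {[]}              _               = refl
pad-peel {suc zero ∷ a}    (lnk , _ ∷ pos) = cong (1 ∷_)
  (trans (cong (pad (length a)) (sym (peel-tail-[] lnk))) (pad-peel (Linked.tail lnk , pos)))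
pad-peel {suc (suc _) ∷ a} (lnk , _ ∷ pos) = cong (_ ∷_) (pad-peel (Linked.tail lnk , pos))

sum-peel : ∀ {a} → IsPartition a → sum a ≡ length a + sum (peel a)
sum-peel {a} pa = trans (cong sum (sym (pad-peel pa))) (sum-pad (length a) (peel a) (length-peel a))

length≤sum : ∀ {a} → All (_> 0) a → length a ≤ sum a
length≤sum []          = z≤n
length≤sum (x>0 ∷ pos) = +-mono-≤ x>0 (length≤sum pos)

sum≡0⇒[] : ∀ {a} → All (_> 0) a → sum a ≡ 0 → a ≡ []
sum≡0⇒[] []        _ = refl
sum≡0⇒[] (z<s ∷ _) ()

0<sum⇒0<length : ∀ {a ℓ} → sum a ≡ suc ℓ → 1 ≤ length a
0<sum⇒0<length {_ ∷ _} _ = z<s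

-- Partitions with length in an interval.

-- Here `ℓ` is the excess of the sum over the least length, and `r` the slack in the length, to
-- match the arguments of `pathCount`.
LengthBetween : ℕ → ℕ → ℕ → List ℕ → Set
LengthBetween ℓ s r a =
  IsPartition a × sum a ≡ suc s + ℓ × suc s ≤ length a × length a ≤ suc s + r

-- Subtracting 1 from each of the `suc s` parts leaves the sum `suc ℓ`, which is positive: between 1
-- and `suc s` parts survive.
lengthExactly-↔ : ∀ ℓ s → [ a ∈ List ℕ ∣ LengthBetween (suc ℓ) s 0 a ] ↔
                          [ b ∈ List ℕ ∣ LengthBetween ℓ 0 s b ]
lengthExactly-↔ ℓ s = refinement-↔ peel (pad (suc s))
  peel-ok
  (λ {b} ((lnk , pos) , eq , _ , len) →
    (pad-linked (suc s) lnk , pad-positive (suc s) b) ,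
    trans (sum-pad (suc s) b len) (cong (suc s +_) eq) ,
    ≤-reflexive (sym (length-pad (suc s) b)) ,
    ≤-reflexive (trans (length-pad (suc s) b) (sym (+-identityʳ (suc s)))))
  (λ {a} (pa , _ , ≤len , len≤) →
    trans (cong (λ n → pad n (peel a)) (sym (lengthIs ≤len len≤))) (pad-peel pa))
  (λ ((_ , pos) , _ , _ , len) → peel-pad (suc s) pos len)
  where
  lengthIs : ∀ {n} → suc s ≤ n → n ≤ suc s + 0 → n ≡ suc s
  lengthIs ≤n n≤ = ≤-antisym (≤-trans n≤ (≤-reflexive (+-identityʳ (suc s)))) ≤n

  peel-ok : ∀ {a} → LengthBetween (suc ℓ) s 0 a → LengthBetween ℓ 0 s (peel a)
  peel-ok {a} (pa@(lnk , _) , eq , ≤len , len≤) =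
    (peel-linked lnk , peel-positive a) , sum≡ , 0<sum⇒0<length {peel a} sum≡ ,
    ≤-trans (length-peel a) (≤-reflexive len≡)
    where
    len≡ : length a ≡ suc s
    len≡ = lengthIs ≤len len≤

    sum≡ : sum (peel a) ≡ suc ℓ
    sum≡ = +-cancelˡ-≡ (suc s) _ _
      (trans (sym (trans (sum-peel pa) (cong (_+ sum (peel a)) len≡))) eq)

-- Partitions of the least length correspond to a left step, longer ones to a right step: there the
-- least length grows by 1 and the excess drops by 1.
lengthBetween-hasSize : ∀ ℓ s r →
  [ a ∈ List ℕ ∣ LengthBetween ℓ s r a ] hasSize pathCount ℓ s r
lengthBetween-hasSize zero s r =
  -- The list of `suc s` ones: with excess 0, every part must be 1.
  refinement-singleton (pad (suc s) [])
    ( (pad-linked (suc s) [] , pad-positive (suc s) [])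
    , sum-pad (suc s) [] z≤n
    , ≤-reflexive (sym (length-pad (suc s) []))
    , ≤-trans (≤-reflexive (length-pad (suc s) [])) (m≤m+n (suc s) r))
    unique
  ⟫ ↔-sym 1↔⊤
  where
  unique : ∀ {a} → LengthBetween 0 s r a → pad (suc s) [] ≡ a
  unique {a} (pa@(_ , pos) , eq , ≤len , _) = begin
    pad (suc s) []          ≡⟨ cong (λ n → pad n []) len≡ ⟨
    pad (length a) []       ≡⟨ cong (pad (length a)) peel≡[] ⟨
    pad (length a) (peel a) ≡⟨ pad-peel pa ⟩
    a                       ∎
    where
    open ≡-Reasoning

    sum≡ : sum a ≡ suc s
    sum≡ = trans eq (+-identityʳ (suc s))

    len≡ : length a ≡ suc s
    len≡ = ≤-antisym (≤-trans (length≤sum pos) (≤-reflexive sum≡)) ≤len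

    peel≡[] : peel a ≡ []
    peel≡[] = sum≡0⇒[] (peel-positive a) (+-cancelˡ-≡ (length a) _ _
      (trans (sym (sum-peel pa)) (trans sum≡ (trans (sym len≡) (sym (+-identityʳ _))))))
lengthBetween-hasSize (suc ℓ) s zero =
  lengthExactly-↔ ℓ s ⟫ lengthBetween-hasSize ℓ 0 s
lengthBetween-hasSize (suc ℓ) s (suc r) =
  refinement-split {D = λ a → length a ≡ suc s} (λ a → length a ≟ suc s)
  ⟫ (shortest ⟫ lengthExactly-↔ ℓ s ⟫ lengthBetween-hasSize ℓ 0 s)
    ⊎-↔ (longer ⟫ lengthBetween-hasSize ℓ (suc s) r)
  ⟫ ↔-sym +↔⊎
  where
  shortest : [ a ∈ List ℕ ∣ LengthBetween (suc ℓ) s (suc r) a × length a ≡ suc s ] ↔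
             [ a ∈ List ℕ ∣ LengthBetween (suc ℓ) s 0 a ]
  shortest = refinement-≡
    (λ ((pa , eq , ≤len , _) , len≡) →
      pa , eq , ≤len , ≤-reflexive (trans len≡ (sym (+-identityʳ (suc s)))))
    (λ (pa , eq , ≤len , len≤) →
      (pa , eq , ≤len , ≤-trans len≤ (+-monoʳ-≤ (suc s) z≤n)) ,
      ≤-antisym (≤-trans len≤ (≤-reflexive (+-identityʳ (suc s)))) ≤len)

  longer : [ a ∈ List ℕ ∣ LengthBetween (suc ℓ) s (suc r) a × ¬ length a ≡ suc s ] ↔
           [ a ∈ List ℕ ∣ LengthBetween ℓ (suc s) r a ]
  longer = refinement-≡
    (λ ((pa , eq , ≤len , len≤) , len≢) →
      pa , trans eq (+-suc (suc s) ℓ) , ≤∧≢⇒< ≤len (len≢ ∘ sym) ,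
      ≤-trans len≤ (≤-reflexive (+-suc (suc s) r)))
    (λ (pa , eq , ≤len , len≤) →
      ( pa , trans eq (sym (+-suc (suc s) ℓ)) , ≤-trans (n≤1+n _) ≤len
      , ≤-trans len≤ (≤-reflexive (sym (+-suc (suc s) r)))) ,
      λ len≡ → <-irrefl (sym len≡) ≤len)

L_B-hasSize : ∀ n → L_B (suc n) hasSize pathCount n 0 n
L_B-hasSize n =
  refinement-≡
    (λ {a} (pa , eq) → pa , eq , 0<sum⇒0<length {a} eq ,
                   ≤-trans (length≤sum (proj₂ pa)) (≤-reflexive eq))
    (λ (pa , eq , _) → pa , eq)
  ⟫ lengthBetween-hasSize n 0 n

L_B-ofLength-hasSize : ∀ {n} ℓ s → suc s + ℓ ≡ n →
                       L_B-ofLength n (suc s) hasSize pathCount ℓ s 0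
L_B-ofLength-hasSize ℓ s refl =
  refinement-≡
    (λ (pa , eq , len≡) → pa , eq , ≤-reflexive (sym len≡) ,
                          ≤-reflexive (trans len≡ (sym (+-identityʳ (suc s)))))
    (λ (pa , eq , ≤len , len≤) → pa , eq ,
      ≤-antisym (≤-trans len≤ (≤-reflexive (+-identityʳ (suc s)))) ≤len)
  ⟫ lengthBetween-hasSize ℓ s 0

-- The recurrence and the values at partitions.

pathCount-recurrence : ∀ ℓ k → 1 ≤ k →
  let c = λ ℓ k → pathCount ℓ (pred k) 0 in
  (ℓ ≡ 0 ⊎ k ≡ 1 → c ℓ k ≡ 1)
  × (¬ (ℓ ≡ 0 ⊎ k ≡ 1) → c ℓ k ≡ ∑[ 1≤ i ≤ ℓ ⊓ k ] c (ℓ ∸ i) i)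
pathCount-recurrence ℓ (suc k) _ =
  (λ { (inj₁ refl) → refl ; (inj₂ refl) → pathCount-0-0 ℓ }) , recurrence ℓ
  where
  recurrence : ∀ ℓ → ¬ (ℓ ≡ 0 ⊎ suc k ≡ 1) →
               pathCount ℓ k 0 ≡ ∑[ 1≤ i ≤ ℓ ⊓ suc k ] pathCount (ℓ ∸ i) (pred i) 0
  recurrence zero    ¬base = contradiction (inj₁ refl) ¬base
  -- After the forced left step `k` right steps are available. The summand at index `suc i` collects
  -- the paths with `i` right steps next, which absorbs the shift in `suc ℓ ⊓ suc k`.
  recurrence (suc ℓ) _     = pathCount-sum ℓ 0 k _ (λ _ → refl)

corollary2 : ∃[ c ] CountsPaths c
    × (∀ ℓ k → 1 ≤ k →
    (ℓ ≡ 0 ⊎ k ≡ 1 → c ℓ k ≡ 1)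
    × (¬ (ℓ ≡ 0 ⊎ k ≡ 1) → c ℓ k ≡ ∑[ 1≤ i ≤ ℓ ⊓ k ] c (ℓ ∸ i) i))
    × (∀ n → 1 ≤ n → L_B n hasSize c n n)
    × (∀ n k → 1 ≤ k → k ≤ n → L_B-ofLength n k hasSize c (n ∸ k) k)
corollary2 =
  (λ ℓ k → pathCount ℓ (pred k) 0) ,
  pathCount-countsPaths ,
  pathCount-recurrence ,
  -- The value at `suc n` and `suc n` is `pathCount (suc n) n 0`, which unfolds to
  -- `pathCount n 0 n`: lengths from 1 to `suc n`.
  (λ { (suc n) _ → L_B-hasSize n }) ,
  (λ { n (suc s) _ k≤n → L_B-ofLength-hasSize (n ∸ suc s) s (m+[n∸m]≡n k≤n) })
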